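{- Any read-once branching program computing MedianBit for $n$ integers from $[2n]$ requires size $2^{n^{\Omega(1)}}$.
   Context: $[N]=\{1,\dots,N\}$. For $n$ input integers, the median is the middle element in sorted order (the $n/2$-th largest when $n$ is even), and MedianBit is the low order bit of the median. A branching program on $n$ inputs from a finite set $D$ (here $D=[2n]$) is a connected directed acyclic multigraph with a source node and possibly many sink nodes; each non-sink node is labeled by an input index in $[n]$ and has exactly one out-edge labeled by each element of $D$; each sink is labeled by an output value. On input $x\in D^n$, the computation starts at the source and at each node queries the input at the node's index and follows the edge labeled by its value, until a sink is reached, whose label is the output. Its size is its number of nodes. It is (syntactic) read-once if no input index appears more than once on any path from the source to a sink; the order of the queries may depend on the input. -}

module Defs where

open import Data.Fin using (Fin; toℕ; fromℕ<; cast)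
import Data.List as List
open import Data.List using (List; length)
open import Data.List.Relation.Binary.Permutation.Propositional.Properties using (↭-length)
open import Data.List.Relation.Unary.Unique.Propositional using (Unique)
open import Data.List.Sort using (sort; sort-↭)
open import Data.Nat using (ℕ; suc; _*_; _^_; _≤_; ⌊_/2⌋; NonZero)
open import Data.Nat.DivMod using (_mod_)
open import Data.Nat.Properties using (≤-decTotalOrder; ⌊n/2⌋<n)
open import Data.Product using (∃-syntax; _×_)
open import Data.Vec using (Vec; lookup; map; toList)
open import Data.Vec.Properties using (length-toList)
open import Relation.Binary.Construct.Closure.Equivalence using (EqClosure)
open import Relation.Binary.Construct.Closure.Transitive using (TransClosure)
open import Relation.Binary.PropositionalEquality using (_≡_; sym; trans)
open import Relation.Nullary using (¬_)

data Node (n : ℕ) (D O V : Set) : Set where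
  query : (i : Fin n) (next : D → V) → Node n D O V
  sink  : (o : O) → Node n D O V

record BranchingProgram (n : ℕ) (D O : Set) : Set where
  field
    size   : ℕ
    node   : Fin size → Node n D O (Fin size)
    source : Fin size

  -- Parallel edges of the multigraph are the distinct d with the same target.
  Edge : Fin size → Fin size → Set
  Edge u v = ∃[ i ] ∃[ next ] ∃[ d ] (node u ≡ query i next × next d ≡ v)

  field
    acyclic   : ∀ v → ¬ TransClosure Edge v v
    connected : ∀ u v → EqClosure Edge u v
    isSource  : ∀ u → ¬ Edge u source

  data Run (x : Vec D n) (v : Fin size) : O → Set where
    halt : ∀ {o} → node v ≡ sink o → Run x v o
    step : ∀ {i next o} → node v ≡ query i next →
           Run x (next (lookup x i)) o → Run x v o

  -- A path of the graph from v to a sink, indexed by the list of input indices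
  -- queried along it.  The edge labels are unconstrained: the path need not be
  -- the computation of any input.
  data PathToSink (v : Fin size) : List (Fin n) → Set where
    end    : ∀ {o} → node v ≡ sink o → PathToSink v List.[]
    follow : ∀ {i next is} → node v ≡ query i next → (d : D) →
             PathToSink (next d) is → PathToSink v (i List.∷ is)

  Computes : (Vec D n → O) → Set
  Computes f = ∀ x → Run x source (f x)

  ReadOnce : Set
  ReadOnce = ∀ {is} → PathToSink source is → Unique is

sorted : List ℕ → List ℕ
sorted = sort ≤-decTotalOrder

length-sorted : ∀ {n} (xs : Vec ℕ n) → length (sorted (toList xs)) ≡ n
length-sorted xs =
  trans (↭-length (sort-↭ ≤-decTotalOrder (toList xs))) (length-toList xs)

-- In increasing order and counting from 0, position ⌊n/2⌋ holds the middle
-- element when n is odd and the n/2-th largest element when n is even.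
middle : ∀ n → .{{NonZero n}} → Fin n
middle (suc n) = fromℕ< (⌊n/2⌋<n n)

median : ∀ {n} → .{{NonZero n}} → Vec ℕ n → ℕ
median {n} xs =
  List.lookup (sorted (toList xs)) (cast (sym (length-sorted xs)) (middle n))

-- Fin N stands for [N] = {1,…,N}, so the element k of Fin N denotes k + 1.
value : ∀ {N} → Fin N → ℕ
value k = suc (toℕ k)

medianBit : ∀ {n N} → .{{NonZero n}} → Vec (Fin N) n → Fin 2
medianBit x = median (map value x) mod 2

-- s ≥ 2 ^ (n ^ (p / q)) for real exponentiation, with q nonzero: the real
-- number n ^ (p / q) is the supremum of the rationals a / b ≥ 0 such that
-- (a / b) ^ q ≤ n ^ p, and for each of them s ≥ 2 ^ (a / b) says 2 ^ a ≤ s ^ b.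
_≥2^[_^_/_] : (s n p q : ℕ) → Set
s ≥2^[ n ^ p / q ] =
  ∀ a b → .{{NonZero b}} → a ^ q ≤ n ^ p * b ^ q → 2 ^ a ≤ s ^ b

{-# OPTIONS --safe #-}

-- On inputs with k fixed values, k < n / 4, let r of them be at most c.  If the
-- free inputs take the values c and c + 1, with c taken exactly ⌊n/2⌋ − r times,
-- then the median is c + 1, and it drops to c as soon as more than r of the fixed
-- values are at most c.  Hence the parity of the median, as a function of the
-- free inputs, determines the multiset of the fixed values.  In a read-once
-- program the inputs queried on the way to a node are never queried again, so
-- all paths of length k leading to the same node read the same multiset.  No
-- path of length less than k ends at a sink, so every sequence of k values is
-- read along some path; reading 2 i or 2 i + 1 at step i gives 2 ^ k multisets
-- and so 2 ^ k nodes.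
module Submission where

open import Defs
open import Data.Bool using (true; false)
open import Data.Fin using (Fin; zero; suc; toℕ; fromℕ<; cast; combine; remQuot)
import Data.Fin.Properties as Fin
open import Data.List using (List; []; _∷_; _++_; _ʳ++_; length; filter; take; allFin)
import Data.List as List
open import Data.List.Membership.Propositional using (_∈_; _∉_)
open import Data.List.Membership.Propositional.Properties
open import Data.List.Membership.DecPropositional using (_∈?_)
import Data.List.Properties as List
open import Data.List.Relation.Binary.Permutation.Propositional using (↭-sym; ↭⇒↭ₛ)
open import Data.List.Relation.Binary.Permutation.Propositional.Properties
  using (filter-↭; ↭-length; ++↭ʳ++)
import Data.List.Relation.Binary.Permutation.Setoid.Properties as Permutationₛ
open import Data.List.Relation.Unary.All as All using (All; []; _∷_)
open import Data.List.Relation.Unary.AllPairs as AllPairs using (AllPairs; []; _∷_)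
import Data.List.Relation.Unary.AllPairs.Properties as AllPairs
open import Data.List.Relation.Unary.Any using (here; there)
open import Data.List.Relation.Unary.Sorted.TotalOrder.Properties using (Sorted⇒AllPairs)
open import Data.List.Relation.Unary.Unique.Propositional using (Unique)
import Data.List.Relation.Unary.Unique.Propositional.Properties as Unique
open import Data.List.Sort using (sort-↭; sort-↗)
open import Data.Nat
open import Data.Nat.DivMod using (_mod_; m≡m%n+[m/n]*n; m%n<n; /-mono-≤)
open import Data.Nat.Properties
open import Data.Nat.Tactic.RingSolver using (solve-∀)
open import Data.Product using (∃-syntax; _×_; _,_; proj₁; proj₂)
open import Data.Sum using (inj₁; inj₂)
open import Data.Vec using (Vec; lookup; tabulate; toList)
import Data.Vec as Vec
open import Data.Vec.Properties using (lookup∘tabulate; tabulate-∘)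
open import Function using (_∘_; const)
open import Relation.Binary.PropositionalEquality
open import Relation.Nullary using (¬_; ¬?; yes; no; contradiction)

private variable
  A : Set
  n N : ℕ

-- Lists without repetitions, and counts of small elements

unique-⊆-length : ∀ {xs ys : List A} → Unique xs → (∀ {x} → x ∈ xs → x ∈ ys) →
                  length xs ≤ length ys
unique-⊆-length {xs = []} _ _ = z≤n
unique-⊆-length {xs = x ∷ xs} (x∉ ∷ xs!) sub with ∈-∃++ (sub (here refl))
... | as , bs , refl = begin
  suc (length xs)              ≤⟨ s≤s (unique-⊆-length xs! sub′) ⟩
  suc (length (as ++ bs))      ≡⟨ cong suc (List.length-++ as) ⟩
  suc (length as + length bs)  ≡⟨ +-suc (length as) (length bs) ⟨
  length as + suc (length bs)  ≡⟨ List.length-++ as ⟨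
  length (as ++ x ∷ bs)        ∎
  where
  open ≤-Reasoning
  sub′ : ∀ {y} → y ∈ xs → y ∈ as ++ bs
  sub′ y∈xs with ∈-++⁻ as (sub (there y∈xs))
  ... | inj₁ y∈as         = ∈-++⁺ˡ y∈as
  ... | inj₂ (here refl)  = contradiction refl (All.lookup x∉ y∈xs)
  ... | inj₂ (there y∈bs) = ∈-++⁺ʳ as y∈bs

unique-++⇒disjoint : ∀ (xs : List A) {ys x} → Unique (xs ++ ys) → x ∈ xs → x ∉ ys
unique-++⇒disjoint (x ∷ xs) (x∉ ∷ _) (here refl) x∈ys = All.lookup x∉ (∈-++⁺ʳ xs x∈ys) refl
unique-++⇒disjoint (_ ∷ xs) (_ ∷ u)  (there x∈)  x∈ys = unique-++⇒disjoint xs u x∈ x∈ys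

count≤ : (A → ℕ) → ℕ → List A → ℕ
count≤ v c xs = length (filter (λ x → v x ≤? c) xs)

count≤-map : ∀ {B : Set} (v : B → ℕ) (g : A → B) c xs →
             count≤ v c (List.map g xs) ≡ count≤ (v ∘ g) c xs
count≤-map v g c [] = refl
count≤-map v g c (x ∷ xs) with v (g x) ≤ᵇ c
... | true  = cong suc (count≤-map v g c xs)
... | false = count≤-map v g c xs

count≤-all : ∀ (v : A → ℕ) {c xs} → All (λ x → v x ≤ c) xs → count≤ v c xs ≡ length xs
count≤-all v {c} ps = cong length (List.filter-all (λ x → v x ≤? c) ps)

count≤-++ : ∀ (v : A → ℕ) c xs ys → count≤ v c (xs ++ ys) ≡ count≤ v c xs + count≤ v c ys
count≤-++ v c xs ys = trans (cong length (List.filter-++ (λ x → v x ≤? c) xs ys))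
                            (List.length-++ (filter (λ x → v x ≤? c) xs))

count≤-∷-cancel : ∀ (v : A → ℕ) c x {xs ys} →
                  count≤ v c (x ∷ xs) ≡ count≤ v c (x ∷ ys) → count≤ v c xs ≡ count≤ v c ys
count≤-∷-cancel v c x eq with v x ≤ᵇ c
... | true  = suc-injective eq
... | false = eq

-- The median through counts at thresholds

value-count : ℕ → List ℕ → ℕ
value-count = count≤ (λ x → x)

-- In a sorted list the entries at most `c` form an initial segment whose length is their count; a
-- head above `c` makes the count zero.
lookup-≤ : ∀ {c xs} → AllPairs _≤_ xs → (i : Fin (length xs)) →
           toℕ i < value-count c xs → List.lookup xs i ≤ c
lookup-≤ {c} {x ∷ xs} (x≤ ∷ xs↗) i i< with x ≤? c
... | no x≰c = contradiction (subst (λ ys → toℕ i < length ys) none i<) λ ()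
  where
  none : filter (_≤? c) (x ∷ xs) ≡ []
  none = List.filter-none (_≤? c) (x≰c ∷ All.map (λ x≤y y≤c → x≰c (≤-trans x≤y y≤c)) x≤)
lookup-≤ {c} {x ∷ xs} (x≤ ∷ xs↗) zero    i< | yes x≤c = x≤c
lookup-≤ {c} {x ∷ xs} (x≤ ∷ xs↗) (suc i) i< | yes x≤c = lookup-≤ xs↗ i
  (s<s⁻¹ (subst (λ ys → suc (toℕ i) < length ys) (List.filter-accept (_≤? c) x≤c) i<))

lookup-> : ∀ {c xs} → AllPairs _≤_ xs → (i : Fin (length xs)) →
           value-count c xs ≤ toℕ i → c < List.lookup xs i
lookup-> {c} {x ∷ xs} (x≤ ∷ xs↗) i ≤i with x ≤? c
lookup-> {c} {x ∷ xs} (x≤ ∷ xs↗) zero    ≤i | no x≰c = ≰⇒> x≰c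
lookup-> {c} {x ∷ xs} (x≤ ∷ xs↗) (suc i) ≤i | no x≰c =
  <-≤-trans (≰⇒> x≰c) (All.lookup x≤ (∈-lookup i))
lookup-> {c} {x ∷ xs} (x≤ ∷ xs↗) i       ≤i | yes x≤c
  with i | subst (λ ys → length ys ≤ toℕ i) (List.filter-accept (_≤? c) x≤c) ≤i
... | suc j | ≤j = lookup-> xs↗ j (s≤s⁻¹ ≤j)

toℕ-middle : ∀ n → .{{_ : NonZero n}} → toℕ (middle n) ≡ ⌊ n /2⌋
toℕ-middle (suc n) = Fin.toℕ-fromℕ< (⌊n/2⌋<n n)

-- Threshold counts are invariant under sorting, so from here on the median is handled by counting
-- alone. Position `⌊ n /2⌋`, counted from 0, lies past the entries at most `c` and within those at
-- most `suc c`.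
median-≡ : .{{_ : NonZero n}} → ∀ {c} (xs : Vec ℕ n) →
           value-count c (toList xs) ≤ ⌊ n /2⌋ → ⌊ n /2⌋ < value-count (suc c) (toList xs) →
           median xs ≡ suc c
median-≡ {n} {c} xs lower upper =
  ≤-antisym (lookup-≤ ↗ i (subst₂ _<_ (sym toℕ-i) (sym (count-sorted (suc c))) upper))
            (lookup-> ↗ i (subst₂ _≤_ (sym (count-sorted c)) (sym toℕ-i) lower))
  where
  i = cast (sym (length-sorted xs)) (middle n)
  ↗ = Sorted⇒AllPairs ≤-totalOrder (sort-↗ ≤-decTotalOrder (toList xs))
  toℕ-i : toℕ i ≡ ⌊ n /2⌋
  toℕ-i = trans (Fin.toℕ-cast (sym (length-sorted xs)) (middle n)) (toℕ-middle n)
  count-sorted : ∀ c → value-count c (sorted (toList xs)) ≡ value-count c (toList xs)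
  count-sorted c = ↭-length (filter-↭ (_≤? c) (sort-↭ ≤-decTotalOrder (toList xs)))

toList-tabulate : (g : Fin n → A) → toList (tabulate g) ≡ List.tabulate g
toList-tabulate {zero}  g = refl
toList-tabulate {suc n} g = cong (g zero ∷_) (toList-tabulate (g ∘ suc))

index-count : ℕ → (Fin n → Fin N) → ℕ
index-count c g = count≤ (value ∘ g) c (allFin _)

value-count-tabulate : ∀ c (g : Fin n → Fin N) →
  value-count c (toList (Vec.map value (tabulate g))) ≡ index-count c g
value-count-tabulate c g = begin
  value-count c (toList (Vec.map value (tabulate g)))
    ≡⟨ cong (value-count c ∘ toList) (tabulate-∘ value g) ⟨
  value-count c (toList (tabulate (value ∘ g)))
    ≡⟨ cong (value-count c) (toList-tabulate (value ∘ g)) ⟩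
  value-count c (List.tabulate (value ∘ g))
    ≡⟨ cong (value-count c) (List.map-tabulate (λ i → i) (value ∘ g)) ⟨
  value-count c (List.map (value ∘ g) (allFin _))
    ≡⟨ count≤-map (λ x → x) (value ∘ g) c (allFin _) ⟩
  index-count c g ∎
  where open ≡-Reasoning

median-tabulate : .{{_ : NonZero n}} → ∀ {c} (g : Fin n → Fin N) →
  index-count c g ≤ ⌊ n /2⌋ → ⌊ n /2⌋ < index-count (suc c) g →
  median (Vec.map value (tabulate g)) ≡ suc c
median-tabulate {c = c} g lower upper = median-≡ (Vec.map value (tabulate g))
  (subst (_≤ _) (sym (value-count-tabulate c g)) lower)
  (subst (_ <_) (sym (value-count-tabulate (suc c) g)) upper)

index-count-≥ : ∀ {c} (g : Fin n → Fin N) {is} → Unique is →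
                (∀ {i} → i ∈ is → value (g i) ≤ c) → length is ≤ index-count c g
index-count-≥ {c = c} g is! small = unique-⊆-length is! λ {i} i∈ →
  ∈-filter⁺ (λ i → value (g i) ≤? c) (∈-allFin i) (small i∈)

index-count-≤ : ∀ {c} (g : Fin n → Fin N) {is} →
                (∀ {i} → value (g i) ≤ c → i ∈ is) → index-count c g ≤ length is
index-count-≤ {n} {c = c} g small =
  unique-⊆-length (Unique.filter⁺ (λ i → value (g i) ≤? c) (Unique.allFin⁺ n))
    (small ∘ proj₂ ∘ ∈-filter⁻ (λ i → value (g i) ≤? c) {xs = allFin n})

mod-2-suc : ∀ m → m mod 2 ≢ suc m mod 2
mod-2-suc (suc (suc m)) = mod-2-suc m

-- Paths as partial assignments

-- The queries along a path, the last one first.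
Partial : ℕ → Set → Set
Partial n D = List (Fin n × D)

keys : ∀ {D} → Partial n D → List (Fin n)
keys = List.map proj₁

complete : ∀ {D} → Partial n D → (Fin n → D) → Fin n → D
complete []            e j = e j
complete ((i , d) ∷ π) e j with i Fin.≟ j
... | yes _ = d
... | no _  = complete π e j

-- In `complete` the most recent entry of a repeated key would win; uniqueness makes every entry of
-- `π` effective.
complete-∈ : ∀ {D} {π : Partial n D} {e i d} → Unique (keys π) → (i , d) ∈ π →
             complete π e i ≡ d
complete-∈ {π = (i , _) ∷ _} _ (here refl) with i Fin.≟ i
... | yes _  = refl
... | no i≢i = contradiction refl i≢i
complete-∈ {π = (j , _) ∷ _} {i = i} (j∉ ∷ π!) (there i∈) with j Fin.≟ i
... | yes refl = contradiction refl (All.lookup j∉ (∈-map⁺ proj₁ i∈))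
... | no _     = complete-∈ π! i∈

complete-∉ : ∀ {D} (π : Partial n D) {e i} → i ∉ keys π → complete π e i ≡ e i
complete-∉ []            i∉ = refl
complete-∉ ((j , _) ∷ π) {i = i} i∉ with j Fin.≟ i
... | yes refl = contradiction (here refl) i∉
... | no _     = complete-∉ π (i∉ ∘ there)

low : ℕ → Partial n (Fin N) → List (Fin n)
low c π = keys (filter (λ q → value (proj₂ q) ≤? c) π)

length-low : ∀ c (π : Partial n (Fin N)) → length (low c π) ≡ count≤ value c (List.map proj₂ π)
length-low c π = trans (List.length-map proj₁ (filter (λ q → value (proj₂ q) ≤? c) π))
                       (sym (count≤-map value proj₂ c π))

length-low-≤ : ∀ c (π : Partial n (Fin N)) → length (low c π) ≤ length π
length-low-≤ c π = begin
  length (low c π)                                    ≡⟨ List.length-map proj₁ (filter _ π) ⟩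
  length (filter (λ q → value (proj₂ q) ≤? c) π)      ≤⟨ List.length-filter _ π ⟩
  length π                                            ∎
  where open ≤-Reasoning

∈-low⁻ : ∀ {c i} (π : Partial n (Fin N)) → i ∈ low c π →
         ∃[ d ] ((i , d) ∈ π × value d ≤ c)
∈-low⁻ {c = c} π i∈ with ∈-map⁻ proj₁ i∈
... | (_ , d) , q∈ , refl = d , ∈-filter⁻ (λ q → value (proj₂ q) ≤? c) q∈

low-⊆-keys : ∀ {c i} (π : Partial n (Fin N)) → i ∈ low c π → i ∈ keys π
low-⊆-keys π i∈ with ∈-low⁻ π i∈
... | _ , q∈ , _ = ∈-map⁺ proj₁ q∈

∈-low⁺ : ∀ {c i d} {π : Partial n (Fin N)} → (i , d) ∈ π → value d ≤ c → i ∈ low c π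
∈-low⁺ {c = c} q∈ d≤c = ∈-map⁺ proj₁ (∈-filter⁺ (λ q → value (proj₂ q) ≤? c) q∈ d≤c)

low-unique : ∀ c {π : Partial n (Fin N)} → Unique (keys π) → Unique (low c π)
low-unique c π! =
  AllPairs.map⁺ (AllPairs.filter⁺ (λ q → value (proj₂ q) ≤? c) (AllPairs.map⁻ π!))

free : List (Fin n) → List (Fin n)
free is = filter (λ i → ¬? (_∈?_ Fin._≟_ i is)) (allFin _)

free-∉ : ∀ (is : List (Fin n)) {i} → i ∈ free is → i ∉ is
free-∉ {n} is i∈ = proj₂ (∈-filter⁻ (λ i → ¬? (_∈?_ Fin._≟_ i is)) {xs = allFin n} i∈)

free-unique : (is : List (Fin n)) → Unique (free is)
free-unique is = Unique.filter⁺ _ (Unique.allFin⁺ _)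

-- Only an inequality, because `is` may contain repetitions, as it does when two paths query a
-- common input and their keys are joined.
length-free : (is : List (Fin n)) → n ≤ length is + length (free is)
length-free {n} is = begin
  n                              ≡⟨ List.length-tabulate {n = n} (λ i → i) ⟨
  length (allFin n)              ≤⟨ unique-⊆-length (Unique.allFin⁺ n) split ⟩
  length (is ++ free is)         ≡⟨ List.length-++ is ⟩
  length is + length (free is)   ∎
  where
  open ≤-Reasoning
  split : ∀ {i} → i ∈ allFin n → i ∈ is ++ free is
  split {i} i∈ with _∈?_ Fin._≟_ i is
  ... | yes i∈is = ∈-++⁺ˡ i∈is
  ... | no i∉is  = ∈-++⁺ʳ is (∈-filter⁺ (λ i → ¬? (_∈?_ Fin._≟_ i is)) i∈ i∉is)

-- Medians of completed partial assignments

complete-count-≤ : ∀ {c} (π : Partial n (Fin N)) {e : Fin n → Fin N} →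
  (∀ i → c < value (e i)) → index-count c (complete π e) ≤ length π
complete-count-≤ {c = c} π {e} large = begin
  index-count c (complete π e) ≤⟨ index-count-≤ (complete π e) fixed ⟩
  length (keys π)              ≡⟨ List.length-map proj₁ π ⟩
  length π                     ∎
  where
  open ≤-Reasoning
  fixed : ∀ {i} → value (complete π e i) ≤ c → i ∈ keys π
  fixed {i} small with _∈?_ Fin._≟_ i (keys π)
  ... | yes i∈ = i∈
  ... | no i∉  =
    contradiction (subst (λ d → value d ≤ c) (complete-∉ π i∉) small) (<⇒≱ (large i))

complete-count-> : ∀ {c h} (π : Partial n (Fin N)) {e : Fin n → Fin N} →
  (∀ i → value (e i) ≤ c) → length π + h < n → h < index-count c (complete π e)
complete-count-> {n} {c = c} {h} π {e} small bound = +-cancelˡ-< (length π) h _ (begin-strict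
  length π + h                               <⟨ bound ⟩
  n                                          ≤⟨ length-free (keys π) ⟩
  length (keys π) + length (free (keys π))
    ≡⟨ cong (_+ length (free (keys π))) (List.length-map proj₁ π) ⟩
  length π + length (free (keys π))
    ≤⟨ +-monoʳ-≤ (length π) (index-count-≥ (complete π e) (free-unique (keys π)) small′) ⟩
  length π + index-count c (complete π e)    ∎)
  where
  open ≤-Reasoning
  small′ : ∀ {i} → i ∈ free (keys π) → value (complete π e i) ≤ c
  small′ {i} i∈ =
    subst (λ d → value d ≤ c) (sym (complete-∉ π (free-∉ (keys π) i∈))) (small i)

median-const : .{{_ : NonZero n}} → ∀ (π : Partial n (Fin N)) d →
  length π ≤ ⌊ n /2⌋ → length π + ⌊ n /2⌋ < n →
  median (Vec.map value (tabulate (complete π (const d)))) ≡ value d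
median-const π d π≤ bound = median-tabulate (complete π (const d))
  (≤-trans (complete-count-≤ π (λ _ → ≤-refl)) π≤)
  (complete-count-> π (λ _ → ≤-refl) bound)

module _ .{{_ : NonZero n}} {lo hi : Fin N} (lo-hi : value hi ≡ suc (value lo)) where

  -- The fixed inputs are too few to move the median away from a constant filling, and the
  -- consecutive values `lo` and `hi` differ in parity. This rules out sinks near the source.
  medianBit-unfixed : ∀ (π : Partial n (Fin N)) →
    length π ≤ ⌊ n /2⌋ → length π + ⌊ n /2⌋ < n →
    medianBit (tabulate (complete π (const lo))) ≢ medianBit (tabulate (complete π (const hi)))
  medianBit-unfixed π π≤ bound eq = mod-2-suc (value lo)
    (trans (cong (_mod 2) (sym (median-const π lo π≤ bound)))
    (trans eq (cong (_mod 2) (trans (median-const π hi π≤ bound) lo-hi))))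

  module _ (π π′ : Partial n (Fin N)) (π! : Unique (keys π)) (π′! : Unique (keys π′))
           (bound : length π + length π′ + ⌊ n /2⌋ < n)
           (π≤ : length π ≤ ⌊ n /2⌋) (π′≤ : length π′ ≤ ⌊ n /2⌋)
           (fewer : length (low (value lo) π) < length (low (value lo) π′)) where

    private
      c = value lo
      h = ⌊ n /2⌋
      r = length (low c π)
      -- Avoiding the inputs fixed by either path lets one filler serve both completions.
      is = keys π ++ keys π′
      -- Together with the `r` low inputs fixed by `π` these make exactly `h` low inputs, the most
      -- for which the median still exceeds `c`.
      lows = take (h ∸ r) (free is)

      r≤h : r ≤ h
      r≤h = ≤-trans (length-low-≤ c π) π≤

      length-lows : length lows ≡ h ∸ r
      length-lows = trans (List.length-take (h ∸ r) (free is)) (m≤n⇒m⊓n≡m enough)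
        where
        open ≤-Reasoning
        length-is : length is ≡ length π + length π′
        length-is = trans (List.length-++ (keys π))
          (cong₂ _+_ (List.length-map proj₁ π) (List.length-map proj₁ π′))
        enough : h ∸ r ≤ length (free is)
        enough = ≤-trans (m∸n≤m h r) (+-cancelˡ-≤ (length π + length π′) h _ (begin
          length π + length π′ + h                  <⟨ bound ⟩
          n                                         ≤⟨ length-free is ⟩
          length is + length (free is)              ≡⟨ cong (_+ length (free is)) length-is ⟩
          length π + length π′ + length (free is)   ∎))

      lows-∉ : ∀ {i} → i ∈ lows → i ∉ is
      lows-∉ = free-∉ is ∘ ∈-take (h ∸ r) (free is)
        where
        ∈-take : ∀ m xs {x : Fin n} → x ∈ take m xs → x ∈ xs
        ∈-take (suc m) (x ∷ xs) (here eq)  = here eq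
        ∈-take (suc m) (x ∷ xs) (there x∈) = there (∈-take m xs x∈)

    filler : Fin n → Fin N
    filler i with _∈?_ Fin._≟_ i lows
    ... | yes _ = lo
    ... | no _  = hi

    private
      lo≤filler : ∀ i → c ≤ value (filler i)
      lo≤filler i with _∈?_ Fin._≟_ i lows
      ... | yes _ = ≤-refl
      ... | no _  = subst (c ≤_) (sym lo-hi) (n≤1+n c)

      filler≤hi : ∀ i → value (filler i) ≤ suc c
      filler≤hi i with _∈?_ Fin._≟_ i lows
      ... | yes _ = n≤1+n c
      ... | no _  = ≤-reflexive lo-hi

      filler-lo : ∀ {i} → i ∈ lows → filler i ≡ lo
      filler-lo {i} i∈ with _∈?_ Fin._≟_ i lows
      ... | yes _ = refl
      ... | no i∉ = contradiction i∈ i∉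

      filler-∈-lows : ∀ {i} → value (filler i) ≤ c → i ∈ lows
      filler-∈-lows {i} small with _∈?_ Fin._≟_ i lows
      ... | yes i∈ = i∈
      ... | no _   = contradiction (subst (_≤ c) lo-hi small) (<⇒≱ ≤-refl)

      -- Inputs fixed only by `π′` lie outside `lows` and so receive `hi`: nothing else is low.
      count-π : index-count c (complete π filler) ≤ h
      count-π = begin
        index-count c (complete π filler)  ≤⟨ index-count-≤ (complete π filler) small ⟩
        length (lows ++ low c π)           ≡⟨ List.length-++ lows ⟩
        length lows + r                    ≡⟨ cong (_+ r) length-lows ⟩
        h ∸ r + r                          ≡⟨ m∸n+n≡m r≤h ⟩
        h                                  ∎
        where
        open ≤-Reasoning
        small : ∀ {i} → value (complete π filler i) ≤ c → i ∈ lows ++ low c π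
        small {i} s with _∈?_ Fin._≟_ i (keys π)
        ... | no i∉ = ∈-++⁺ˡ (filler-∈-lows (subst (λ d → value d ≤ c) (complete-∉ π i∉) s))
        ... | yes i∈ with ∈-map⁻ proj₁ i∈
        ...   | _ , q∈ , refl = ∈-++⁺ʳ lows
          (∈-low⁺ q∈ (subst (λ d → value d ≤ c) (complete-∈ π! q∈) s))

      count-π′ : h < index-count c (complete π′ filler)
      count-π′ = begin-strict
        h                                   ≡⟨ m∸n+n≡m r≤h ⟨
        h ∸ r + r                           <⟨ +-monoʳ-< (h ∸ r) fewer ⟩
        h ∸ r + length (low c π′)           ≡⟨ cong (_+ length (low c π′)) length-lows ⟨
        length lows + length (low c π′)     ≡⟨ List.length-++ lows ⟨
        length (lows ++ low c π′)           ≤⟨ index-count-≥ (complete π′ filler) unique small ⟩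
        index-count c (complete π′ filler)  ∎
        where
        open ≤-Reasoning
        unique : Unique (lows ++ low c π′)
        unique = Unique.++⁺ (Unique.take⁺ (h ∸ r) (free-unique is)) (low-unique c π′!)
          λ (i∈ , i∈′) → lows-∉ i∈ (∈-++⁺ʳ (keys π) (low-⊆-keys π′ i∈′))
        small : ∀ {i} → i ∈ lows ++ low c π′ → value (complete π′ filler i) ≤ c
        small {i} i∈ with ∈-++⁻ lows i∈
        ... | inj₁ i∈lows = ≤-reflexive (cong value
          (trans (complete-∉ π′ (lows-∉ i∈lows ∘ ∈-++⁺ʳ (keys π))) (filler-lo i∈lows)))
        ... | inj₂ i∈low with ∈-low⁻ π′ i∈low
        ...   | d , q∈ , d≤c = subst (λ d → value d ≤ c) (sym (complete-∈ π′! q∈)) d≤c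

    -- The filler leaves at most `h` low inputs under `π` but more than `h` under `π′`, so the
    -- medians are the consecutive values `hi` and `lo`.
    medianBit-distinguishes :
      medianBit (tabulate (complete π filler)) ≢ medianBit (tabulate (complete π′ filler))
    medianBit-distinguishes eq = mod-2-suc c
      (trans (cong (_mod 2) (sym median-π′)) (trans (sym eq) (cong (_mod 2) median-π)))
      where
      median-π : median (Vec.map value (tabulate (complete π filler))) ≡ suc c
      median-π = median-tabulate (complete π filler) count-π
        (complete-count-> π filler≤hi
          (≤-<-trans (+-monoˡ-≤ h (m≤m+n (length π) (length π′))) bound))
      median-π′ : median (Vec.map value (tabulate (complete π′ filler))) ≡ c
      -- As `c` is `suc (toℕ lo)`, the lower threshold is `toℕ lo`: no free input is that small, and
      -- at most `h` inputs are fixed.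
      median-π′ = median-tabulate (complete π′ filler)
        (≤-trans (complete-count-≤ π′ lo≤filler) π′≤) count-π′

-- Read-once branching programs

module _ {D O : Set} (P : BranchingProgram n D O) where
  open BranchingProgram P

  -- A path from the source with arbitrary edge labels. Consistency with some input is not built in;
  -- in a read-once program it follows from `reach-unique`.
  data Reach : Fin size → Partial n D → Set where
    start  : Reach source []
    extend : ∀ {v i next π} → Reach v π → node v ≡ query i next → (d : D) →
             Reach (next d) ((i , d) ∷ π)

  sink-or-query : ∀ {v o i next} → node v ≡ sink o → node v ≢ query i next
  sink-or-query p q with trans (sym p) q
  ... | ()

  run-deterministic : ∀ {x v o o′} → Run x v o → Run x v o′ → o ≡ o′
  run-deterministic (halt p)   (halt q) with refl ← trans (sym p) q = refl
  run-deterministic (halt p)   (step q _) = contradiction q (sink-or-query p)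
  run-deterministic (step p _) (halt q)   = contradiction p (sink-or-query q)
  run-deterministic (step p r) (step q s) with refl ← trans (sym p) q = run-deterministic r s

  run-after : ∀ {x v o π} → Reach v π → All (λ (i , d) → lookup x i ≡ d) π →
              Run x source o → Run x v o
  run-after start _ r = r
  run-after (extend {next = next} ρ q d) (refl ∷ eqs) r with run-after ρ eqs r
  ... | halt p = contradiction q (sink-or-query p)
  ... | step p s with refl ← trans (sym p) q = s

  run-path : ∀ {x v o} → Run x v o → ∃[ js ] (PathToSink v js)
  run-path (halt p) = [] , end p
  run-path {x} (step {i} p r) = _ , follow p (lookup x i) (proj₂ (run-path r))

  reach-path : ∀ {v π is} → Reach v π → PathToSink v is → PathToSink source (keys π ʳ++ is)
  reach-path start          path = path
  reach-path (extend ρ q d) path = reach-path ρ (follow q d path)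

  -- The run of `x` itself traces a path to a sink, so its current query lies on such a path and
  -- both inputs take the same edge.
  run-agree : ∀ {x y v o} → (∀ {is i} → PathToSink v is → i ∈ is → lookup x i ≡ lookup y i) →
              Run x v o → Run y v o
  run-agree agree (halt p) = halt p
  run-agree {x} {y} {o = o} agree (step {i} {next} p r) =
    step p (subst (λ d → Run y (next d) o)
      (agree (follow p (lookup x i) (proj₂ (run-path r))) (here refl))
      (run-agree (λ path i∈ → agree (follow p (lookup x i) path) (there i∈)) r))

  module _ (readOnce : ReadOnce) {f : Vec D n → O} (computes : Computes f) where

    -- The two paths concatenate into one from the source to a sink, to which the read-once property
    -- applies.
    reach-disjoint : ∀ {v π is i} → Reach v π → PathToSink v is → i ∈ is → i ∉ keys π
    reach-disjoint {π = π} {is} ρ path i∈is i∈π =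
      unique-++⇒disjoint (keys π) unique i∈π i∈is
      where
      unique : Unique (keys π ++ is)
      unique = Permutationₛ.Unique-resp-↭ (setoid (Fin n))
        (↭⇒↭ₛ (↭-sym (++↭ʳ++ (keys π) is))) (readOnce (reach-path ρ path))

    run-complete : ∀ {v π} → Reach v π → Unique (keys π) → ∀ e →
                   Run (tabulate (complete π e)) v (f (tabulate (complete π e)))
    run-complete {π = π} ρ π! e = run-after ρ
      (All.tabulate λ {(i , _)} q∈ → trans (lookup∘tabulate (complete π e) i) (complete-∈ π! q∈))
      (computes _)

    -- The read-once property speaks only of paths that reach a sink, so the path to `v` is first
    -- continued to one: by induction `π` is consistent, and the run of any of its completions
    -- passes through `v` and halts.
    reach-unique : ∀ {v π} → Reach v π → Unique (keys π)
    reach-unique start = []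
    reach-unique (extend {i = i} {π = π} ρ q d) =
      All.tabulate (λ { j∈ refl → i∉ j∈ }) ∷ π!
      where
      π! = reach-unique ρ
      i∉ : i ∉ keys π
      -- `d` is merely an available default for the free inputs.
      i∉ with run-complete ρ π! (const d)
      ... | halt p = contradiction q (sink-or-query p)
      ... | step p r with refl ← trans (sym p) q =
        reach-disjoint ρ (follow q _ (proj₂ (run-path r))) (here refl)

    -- Inputs on which the completions differ were queried on one of the two paths, so they are not
    -- queried from `v` on, and both runs coincide from there.
    reach-≡ : ∀ {v π π′} → Reach v π → Reach v π′ → ∀ e →
              f (tabulate (complete π e)) ≡ f (tabulate (complete π′ e))
    reach-≡ {π = π} {π′} ρ ρ′ e = run-deterministic
      (run-agree agree (run-complete ρ (reach-unique ρ) e))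
      (run-complete ρ′ (reach-unique ρ′) e)
      where
      open ≡-Reasoning
      agree : ∀ {is i} → PathToSink _ is → i ∈ is →
              lookup (tabulate (complete π e)) i ≡ lookup (tabulate (complete π′ e)) i
      agree {i = i} path i∈ = begin
        lookup (tabulate (complete π e)) i    ≡⟨ lookup∘tabulate (complete π e) i ⟩
        complete π e i                        ≡⟨ complete-∉ π (reach-disjoint ρ path i∈) ⟩
        e i                                   ≡⟨ complete-∉ π′ (reach-disjoint ρ′ path i∈) ⟨
        complete π′ e i                       ≡⟨ lookup∘tabulate (complete π′ e) i ⟨
        lookup (tabulate (complete π′ e)) i   ∎

    reach-sink : ∀ {v π o} → Reach v π → node v ≡ sink o → ∀ e →
                 f (tabulate (complete π e)) ≡ o
    reach-sink ρ p e = run-deterministic (run-complete ρ (reach-unique ρ) e) (halt p)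

    -- The list ds is read from its last element to its first.
    walk : ∀ ds → (∀ {v π o} → Reach v π → length π < length ds → node v ≢ sink o) →
           ∃[ v ] ∃[ π ] (Reach v π × List.map proj₂ π ≡ ds)
    walk []       _      = source , [] , start , refl
    walk (d ∷ ds) noSink with walk ds (λ ρ π< → noSink ρ (m<n⇒m<1+n π<))
    ... | v , π , ρ , refl with node v in eq
    ...   | sink o       =
      contradiction eq (noSink ρ (s≤s (≤-reflexive (sym (List.length-map proj₂ π)))))
    -- Whichever input is queried, an edge labeled `d` leaves the node.
    ...   | query i next = next d , (i , d) ∷ π , extend ρ eq d , refl

-- Words with pairwise distinct multisets of values

digit : Fin n → Fin 2 → Fin (2 * n)
digit {n} i b = cast (*-comm n 2) (combine i b)

toℕ-digit : ∀ (i : Fin n) b → toℕ (digit i b) ≡ 2 * toℕ i + toℕ b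
toℕ-digit {n} i b = trans (Fin.toℕ-cast (*-comm n 2) (combine i b)) (Fin.toℕ-combine i b)

-- The binary digits of `a`, most significant first, each choosing between two values. The head of a
-- word of length `suc k` is `2 k + 1` or `2 k + 2` in [2n], so the pairs for different positions
-- are disjoint and decrease along the list.
word : ∀ k → k ≤ n → Fin (2 ^ k) → List (Fin (2 * n))
word zero    _   _ = []
word (suc k) k<n a =
  digit (fromℕ< k<n) (proj₁ (remQuot {2} (2 ^ k) a)) ∷
  word k (<⇒≤ k<n) (proj₂ (remQuot {2} (2 ^ k) a))

length-word : ∀ k (k≤n : k ≤ n) a → length (word k k≤n a) ≡ k
length-word zero    _   _ = refl
length-word (suc k) k<n a = cong suc (length-word k _ _)

word-≤ : ∀ k (k≤n : k ≤ n) a → All (λ d → value d ≤ 2 * k) (word k k≤n a)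
word-≤ zero    _   _ = []
word-≤ (suc k) k<n a =
  (begin
    suc (toℕ (digit (fromℕ< k<n) b))       ≡⟨ cong suc (toℕ-digit (fromℕ< k<n) b) ⟩
    suc (2 * toℕ (fromℕ< k<n) + toℕ b)
      ≡⟨ cong (λ m → suc (2 * m + toℕ b)) (Fin.toℕ-fromℕ< k<n) ⟩
    suc (2 * k + toℕ b)                    ≡⟨ +-suc (2 * k) (toℕ b) ⟨
    2 * k + suc (toℕ b)                    ≤⟨ +-monoʳ-≤ (2 * k) (Fin.toℕ<n b) ⟩
    2 * k + 2                              ≡⟨ +-comm (2 * k) 2 ⟩
    2 + 2 * k                              ≡⟨ *-suc 2 k ⟨
    2 * suc k                              ∎)
  ∷ All.map (λ d≤ → ≤-trans d≤ (*-monoʳ-≤ 2 (n≤1+n k))) (word-≤ k _ _)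
  where
  open ≤-Reasoning
  b = proj₁ (remQuot {2} (2 ^ k) a)

value-digit-0 : ∀ (i : Fin n) → value (digit i zero) ≡ suc (2 * toℕ i)
value-digit-0 i = cong suc (trans (toℕ-digit i zero) (+-identityʳ _))

value-digit-1 : ∀ (i : Fin n) → value (digit i (suc zero)) ≡ suc (value (digit i zero))
value-digit-1 i =
  trans (cong suc (trans (toℕ-digit i (suc zero)) (+-comm _ 1))) (cong suc (sym (value-digit-0 i)))

-- At this threshold all the smaller entries are counted, and the head is counted exactly when its
-- bit is `zero`; equal lengths let the rest cancel.
digit-count-injective : ∀ (i : Fin n) {b b′ ds ds′} → length ds ≡ length ds′ →
  All (λ d → value d ≤ 2 * toℕ i) ds → All (λ d → value d ≤ 2 * toℕ i) ds′ →
  count≤ value (value (digit i zero)) (digit i b ∷ ds) ≡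
  count≤ value (value (digit i zero)) (digit i b′ ∷ ds′) → b ≡ b′
digit-count-injective i {b} {b′} {ds} {ds′} len small small′ eq = go b b′ (begin
  count≤ value c (digit i b ∷ [])  + length ds                  ≡⟨ split b small ⟨
  count≤ value c (digit i b ∷ ds)                               ≡⟨ eq ⟩
  count≤ value c (digit i b′ ∷ ds′)                             ≡⟨ split b′ small′ ⟩
  count≤ value c (digit i b′ ∷ [])  + length ds′                ≡⟨ cong (_ +_) (sym len) ⟩
  count≤ value c (digit i b′ ∷ [])  + length ds                 ∎)
  where
  open ≡-Reasoning
  c = value (digit i zero)
  split : ∀ b {ds} → All (λ d → value d ≤ 2 * toℕ i) ds →
          count≤ value c (digit i b ∷ ds) ≡ count≤ value c (digit i b ∷ []) + length ds
  split b {ds} small = begin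
    count≤ value c ((digit i b ∷ []) ++ ds)              ≡⟨ count≤-++ value c (digit i b ∷ []) ds ⟩
    count≤ value c (digit i b ∷ []) + count≤ value c ds
      ≡⟨ cong (count≤ value c (digit i b ∷ []) +_) (count≤-all value (All.map widen small)) ⟩
    count≤ value c (digit i b ∷ []) + length ds          ∎
    where
    widen : ∀ {m} → m ≤ 2 * toℕ i → m ≤ c
    widen m≤ = ≤-trans m≤ (≤-trans (n≤1+n _) (≤-reflexive (sym (value-digit-0 i))))
  count-0 : count≤ value c (digit i zero ∷ []) ≡ 1
  count-0 = count≤-all value {c} {digit i zero ∷ []} (≤-refl ∷ [])
  count-1 : count≤ value c (digit i (suc zero) ∷ []) ≡ 0
  count-1 = cong length (List.filter-none (λ d → value d ≤? c)
    {xs = digit i (suc zero) ∷ []} (<⇒≱ (≤-reflexive (sym (value-digit-1 i))) ∷ []))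
  go : ∀ b b′ → count≤ value c (digit i b ∷ []) + length ds ≡
                count≤ value c (digit i b′ ∷ []) + length ds → b ≡ b′
  go zero       zero       _  = refl
  go (suc zero) (suc zero) _  = refl
  go zero       (suc zero) eq =
    contradiction (trans (sym count-0) (trans (+-cancelʳ-≡ _ _ _ eq) count-1)) λ ()
  go (suc zero) zero       eq =
    contradiction (trans (sym count-0) (trans (sym (+-cancelʳ-≡ _ _ _ eq)) count-1)) λ ()

-- The threshold at the head's own pair recovers the top bit, after which the equal heads cancel
-- from every count. Each threshold `digit i zero` has the successor `digit i (suc zero)`, as the
-- median argument requires.
word-injective : ∀ {n} k (k≤n : k ≤ n) a a′ →
  (∀ (i : Fin n) → count≤ value (value (digit i zero)) (word k k≤n a) ≡
         count≤ value (value (digit i zero)) (word k k≤n a′)) → a ≡ a′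
word-injective zero    _   zero zero _ = refl
word-injective {n} (suc k) k<n a    a′   eq = begin
  a                                     ≡⟨ Fin.combine-remQuot {2} (2 ^ k) a ⟨
  combine (proj₁ (digits a)) (proj₂ (digits a))    ≡⟨ cong₂ combine heads tails ⟩
  combine (proj₁ (digits a′)) (proj₂ (digits a′))  ≡⟨ Fin.combine-remQuot {2} (2 ^ k) a′ ⟩
  a′                                    ∎
  where
  open ≡-Reasoning
  digits : Fin (2 ^ suc k) → Fin 2 × Fin (2 ^ k)
  digits = remQuot {2} (2 ^ k)
  i = fromℕ< k<n
  tail : Fin (2 ^ suc k) → List (Fin (2 * n))
  tail a = word k (<⇒≤ k<n) (proj₂ (digits a))
  small : ∀ a → All (λ d → value d ≤ 2 * toℕ i) (tail a)
  small a = subst (λ m → All (λ d → value d ≤ 2 * m) (tail a)) (sym (Fin.toℕ-fromℕ< k<n))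
    (word-≤ k (<⇒≤ k<n) _)
  heads : proj₁ (digits a) ≡ proj₁ (digits a′)
  heads = digit-count-injective i {proj₁ (digits a)} {proj₁ (digits a′)}
    {ds = tail a} {ds′ = tail a′}
    (trans (length-word k (<⇒≤ k<n) _) (sym (length-word k (<⇒≤ k<n) _)))
    (small a) (small a′) (eq i)
  tails : proj₂ (digits a) ≡ proj₂ (digits a′)
  tails = word-injective k (<⇒≤ k<n) _ _ λ j → let c = value (digit j zero) in
    count≤-∷-cancel value c (digit i (proj₁ (digits a))) {tail a} {tail a′}
      (trans (eq j) (cong (λ b → count≤ value c (digit i b ∷ tail a′)) (sym heads)))

-- Many words, hence many nodes

module _ .{{_ : NonZero n}} (P : BranchingProgram n (Fin (2 * n)) (Fin 2))
         (readOnce : BranchingProgram.ReadOnce P)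
         (computes : BranchingProgram.Computes P medianBit)
         {k : ℕ} (k≤n : k ≤ n) (k≤h : k ≤ ⌊ n /2⌋) (bound : k + k + ⌊ n /2⌋ < n) where
  open BranchingProgram P

  private
    0<n : 0 < n
    0<n = m<n⇒0<n bound

    noSink : ∀ {v π o} → Reach P v π → length π ≤ k → node v ≢ sink o
    -- The two consecutive values are 1 and 2, the pair at position 0.
    noSink {π = π} ρ π≤k p = medianBit-unfixed (value-digit-1 (fromℕ< 0<n)) π
      (≤-trans π≤k k≤h)
      (≤-<-trans (+-monoˡ-≤ ⌊ n /2⌋ (≤-trans π≤k (m≤m+n k k))) bound)
      (trans (reach-sink P readOnce computes ρ p _) (sym (reach-sink P readOnce computes ρ p _)))

    -- A strictly smaller count for `π` would give a filler on which the completions have different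
    -- median bits, although both paths end at `v`.
    reach-count-≥ : ∀ {v π π′} → Reach P v π → Reach P v π′ →
      length π ≤ k → length π′ ≤ k → ∀ (i : Fin n) →
      length (low (value (digit i zero)) π′) ≤ length (low (value (digit i zero)) π)
    reach-count-≥ {π = π} {π′} ρ ρ′ π≤k π′≤k i = ≮⇒≥ λ fewer →
      medianBit-distinguishes (value-digit-1 i) π π′
        (reach-unique P readOnce computes ρ) (reach-unique P readOnce computes ρ′)
        (≤-<-trans (+-monoˡ-≤ ⌊ n /2⌋ (+-mono-≤ π≤k π′≤k)) bound)
        (≤-trans π≤k k≤h) (≤-trans π′≤k k≤h) fewer
        (reach-≡ P readOnce computes ρ ρ′ _)

    reach-count : ∀ {v π π′} → Reach P v π → Reach P v π′ →
      length π ≤ k → length π′ ≤ k → ∀ (i : Fin n) →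
      count≤ value (value (digit i zero)) (List.map proj₂ π) ≡
      count≤ value (value (digit i zero)) (List.map proj₂ π′)
    reach-count {π = π} {π′} ρ ρ′ π≤k π′≤k i = begin
      count≤ value c (List.map proj₂ π)    ≡⟨ length-low c π ⟨
      length (low c π)                     ≡⟨ ≤-antisym (reach-count-≥ ρ′ ρ π′≤k π≤k i)
                                                        (reach-count-≥ ρ ρ′ π≤k π′≤k i) ⟩
      length (low c π′)                    ≡⟨ length-low c π′ ⟩
      count≤ value c (List.map proj₂ π′)   ∎
      where
      open ≡-Reasoning
      c = value (digit i zero)

    walk-word : ∀ a → ∃[ v ] ∃[ π ] (Reach P v π × List.map proj₂ π ≡ word k k≤n a)
    walk-word a = walk P readOnce computes (word k k≤n a)
      λ ρ π< → noSink ρ (≤-trans (<⇒≤ π<) (≤-reflexive (length-word k k≤n a)))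

    word-length-≤ : ∀ {a} {π : Partial n (Fin (2 * n))} →
                    List.map proj₂ π ≡ word k k≤n a → length π ≤ k
    word-length-≤ {a} {π} eq = ≤-reflexive
      (trans (sym (List.length-map proj₂ π)) (trans (cong length eq) (length-word k k≤n a)))

    -- Paths ending at the same node have equal counts at all thresholds `digit i zero`, and these
    -- determine the word.
    walk-injective : ∀ {a a′} → proj₁ (walk-word a) ≡ proj₁ (walk-word a′) → a ≡ a′
    walk-injective {a} {a′} v≡ with walk-word a | walk-word a′ | v≡
    ... | _ , π , ρ , eq | _ , π′ , ρ′ , eq′ | refl = word-injective k k≤n a a′ λ (i : Fin n) →
      subst₂ (λ ds ds′ → count≤ value (value (digit i zero)) ds ≡
                         count≤ value (value (digit i zero)) ds′) eq eq′
        (reach-count ρ ρ′ (word-length-≤ {a} eq) (word-length-≤ {a′} eq′) i)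

  size-≥-2^k : 2 ^ k ≤ size
  size-≥-2^k = Fin.injective⇒≤ walk-injective

-- Real exponents and the choice of `k`

^-distribʳ-* : ∀ q a b → (a * b) ^ q ≡ a ^ q * b ^ q
^-distribʳ-* zero    a b = refl
^-distribʳ-* (suc q) a b =
  trans (cong (a * b *_) (^-distribʳ-* q a b)) ([m*n]*[o*p]≡[m*o]*[n*p] a b (a ^ q) (b ^ q))

^-cancelˡ-≤ : ∀ q .{{_ : NonZero q}} {a b} → a ^ q ≤ b ^ q → a ≤ b
^-cancelˡ-≤ q a^q≤b^q = ≮⇒≥ λ b<a → <⇒≱ (^-monoˡ-< q b<a) a^q≤b^q

-- Every admissible `a / b` is at most `k`: taking `q`-th roots in `a ^ q ≤ (k * b) ^ q` gives
-- `a ≤ k * b`.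
≥2^-intro : ∀ {s n k} p q .{{_ : NonZero q}} → n ^ p ≤ k ^ q → 2 ^ k ≤ s → s ≥2^[ n ^ p / q ]
≥2^-intro {s} {n} {k} p q n^p≤k^q 2^k≤s a b a^q≤ = begin
  2 ^ a        ≤⟨ ^-monoʳ-≤ 2 (^-cancelˡ-≤ q a^q≤[kb]^q) ⟩
  2 ^ (k * b)  ≡⟨ ^-*-assoc 2 k b ⟨
  (2 ^ k) ^ b  ≤⟨ ^-monoˡ-≤ b 2^k≤s ⟩
  s ^ b        ∎
  where
  open ≤-Reasoning
  a^q≤[kb]^q : a ^ q ≤ (k * b) ^ q
  a^q≤[kb]^q = begin
    a ^ q          ≤⟨ a^q≤ ⟩
    n ^ p * b ^ q  ≤⟨ *-monoˡ-≤ (b ^ q) n^p≤k^q ⟩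
    k ^ q * b ^ q  ≡⟨ ^-distribʳ-* q k b ⟨
    (k * b) ^ q    ∎

module _ {n : ℕ} (72≤n : 72 ≤ n) where
  private
    k = n / 8
    h = ⌊ n /2⌋
    open ≤-Reasoning

    9≤k : 9 ≤ k
    9≤k = /-mono-≤ {o = 8} 72≤n ≤-refl

    8k≤n : 8 * k ≤ n
    8k≤n = begin
      8 * k         ≡⟨ *-comm 8 k ⟩
      k * 8         ≤⟨ m≤n+m (k * 8) (n % 8) ⟩
      n % 8 + k * 8 ≡⟨ m≡m%n+[m/n]*n n 8 ⟨
      n             ∎

  n/8-≤ : n / 8 ≤ n
  n/8-≤ = ≤-trans (m≤m+n k (7 * k)) 8k≤n

  private
    4k≤h : 4 * k ≤ h
    4k≤h = begin
      4 * k             ≡⟨ n≡⌊n+n/2⌋ (4 * k) ⟩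
      ⌊ 4 * k + 4 * k /2⌋ ≡⟨ cong ⌊_/2⌋ (*-distribʳ-+ k 4 4) ⟨
      ⌊ 8 * k /2⌋       ≤⟨ ⌊n/2⌋-mono 8k≤n ⟩
      h                 ∎

  n/8-≤-half : n / 8 ≤ ⌊ n /2⌋
  n/8-≤-half = ≤-trans (m≤m+n k (3 * k)) 4k≤h

  -- Even `4 * k` fits into half of the inputs, so `2 * k` does with room to spare, `k` being
  -- positive.
  n/8-bound : n / 8 + n / 8 + ⌊ n /2⌋ < n
  n/8-bound = begin-strict
    k + k + h       <⟨ +-monoˡ-< h (m<m+n (k + k) (≤-trans (s≤s z≤n) (≤-trans 9≤k (m≤m+n k k)))) ⟩
    k + k + (k + k) + h ≡⟨ cong (_+ h) (four k) ⟩
    4 * k + h       ≤⟨ +-monoˡ-≤ h 4k≤h ⟩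
    h + h           ≤⟨ +-monoʳ-≤ h (⌊n/2⌋≤⌈n/2⌉ n) ⟩
    h + ⌈ n /2⌉     ≡⟨ ⌊n/2⌋+⌈n/2⌉≡n n ⟩
    n               ∎
    where
    four : ∀ k → k + k + (k + k) ≡ 4 * k
    four = solve-∀

  -- The remainder is below 8, hence at most `k`, so `n ≤ 9 * k ≤ k * k`. The need for `9 ≤ k` is
  -- the origin of 72 as `8 * 9`.
  n≤[n/8]^2 : n ^ 1 ≤ (n / 8) ^ 2
  n≤[n/8]^2 = begin
    n ^ 1           ≡⟨ ^-identityʳ n ⟩
    n               ≡⟨ m≡m%n+[m/n]*n n 8 ⟩
    n % 8 + k * 8   ≤⟨ +-monoˡ-≤ (k * 8) (≤-trans (<⇒≤ (m%n<n n 8)) (≤-trans (n≤1+n 8) 9≤k)) ⟩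
    k + k * 8       ≡⟨ *-suc k 8 ⟨
    k * 9           ≤⟨ *-monoʳ-≤ k 9≤k ⟩
    k * k           ≡⟨ cong (k *_) (*-identityʳ k) ⟨
    k ^ 2           ∎

corollary10 : ∃[ p ] ∃[ q ] ∃[ n₀ ] (NonZero p × NonZero q ×
    (∀ n → .{{_ : NonZero n}} → n₀ ≤ n →
    (P : BranchingProgram n (Fin (2 * n)) (Fin 2)) →
    BranchingProgram.ReadOnce P →
    BranchingProgram.Computes P medianBit →
    BranchingProgram.size P ≥2^[ n ^ p / q ]))
-- The exponent is 1/2, since `n / 8` is at least the square root of `n` once `n` reaches 72.
corollary10 = 1 , 2 , 72 , _ , _ , λ n 72≤n P readOnce computes →
  ≥2^-intro {n = n} {n / 8} 1 2 (n≤[n/8]^2 72≤n)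
    (size-≥-2^k P readOnce computes {n / 8} (n/8-≤ 72≤n) (n/8-≤-half 72≤n) (n/8-bound 72≤n))
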